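{- Suppose the Coffman–Sethi conjecture is false. Then every minimal counterexample of Type IR and every minimal counterexample of Type I, having $k$ ranks, satisfies $\frac{t_{LD}}{t^*}<\frac{k}{k-1}$.
   Context: Problem FM: there are $m\ge 1$ identical parallel machines and $n=mk$ jobs ($k\ge 1$ is the number of ranks; an instance with fewer jobs is padded with jobs of processing time $0$), with nonnegative real processing times indexed so that $p_1\ge p_2\ge\cdots\ge p_n$. For $r\in\{1,\dots,k\}$, rank $r$ is the set of jobs $(r-1)m+1,\dots,rm$. A flowtime-optimal schedule assigns to every machine exactly one job from each rank and processes the jobs on each machine consecutively from time $0$ without idle time, in the order rank $k$, rank $k-1$, \dots, rank $1$; its makespan is the largest machine completion time. $t^*$ denotes the minimum makespan over all flowtime-optimal schedules; flowtime-optimal schedules attaining it are optimal, and a schedule is rectangular if all machines have the same completion time. LD algorithm: ranks are handled in the order $1,2,\dots,k$; when handling a rank, the largest job of that rank is assigned to a machine of smallest current load (sum of processing times of jobs already assigned), the second largest to a machine of second smallest load, \dots, the smallest to a machine of largest load (ties broken arbitrarily); at the end the order of jobs on each machine is reversed, yielding a flowtime-optimal schedule. Any schedule obtainable this way is an LD schedule. The Coffman–Sethi conjecture asserts that for every $m$, every instance on $m$ machines and every LD schedule, the makespan of the LD schedule is at most $\frac{5m-2}{4m-1}t^*$; a counterexample is an instance having an LD schedule violating this. Here $t_{LD}$ denotes the largest makespan over the LD schedules of the instance, and $t_{LD}/t^*$ is its approximation ratio. Types: any instance is of Type A; Type I if all processing times are integers; Type R if it has a rectangular optimal schedule; Type IR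 if it is of Types I and R. A counterexample of a given type is a counterexample which is an instance of that type. A counterexample $P_2$ is smaller than a counterexample $P_1$ with $k$ ranks and $m$ machines if (i) $P_2$ has fewer than $k$ ranks, or (ii) $P_2$ has $k$ ranks and fewer than $m$ machines, or (iii) $P_2$ has $k$ ranks, $m$ machines and fewer jobs with nonzero processing time, or (iv) $P_2$ has $k$ ranks, $m$ machines, the same number of jobs with nonzero processing time and a strictly larger approximation ratio, or (v) (for types requiring integer data) $P_2$ has $k$ ranks, $m$ machines, the same number of nonzero jobs, the same approximation ratio and a strictly smaller sum of processing times. A minimal counterexample of a given type is a counterexample of that type such that no counterexample of the same type is smaller than it. -}

module Defs where

open import Data.Nat using (ℕ; zero; suc; _+_; _*_; _∸_; _≤_; _<_; _⊔_; _<ᵇ_; _≡ᵇ_)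
open import Data.Fin using (Fin; toℕ) renaming (zero to fzero; suc to fsuc)
open import Data.Fin.Permutation using (Permutation′; _⟨$⟩ʳ_; _⟨$⟩ˡ_)
open import Data.Bool using (if_then_else_)
open import Data.Product using (Σ; ∃; ∃-syntax; _×_; _,_)
open import Data.Sum using (_⊎_)
open import Data.Unit using (⊤)
open import Relation.Binary.PropositionalEquality using (_≡_)
open import Relation.Nullary using (¬_)

sumFin : (n : ℕ) → (Fin n → ℕ) → ℕ
sumFin zero    f = 0
sumFin (suc n) f = f fzero + sumFin n (λ i → f (fsuc i))

maxFin : (n : ℕ) → (Fin n → ℕ) → ℕ
maxFin zero    f = 0
maxFin (suc n) f = f fzero ⊔ maxFin n (λ i → f (fsuc i))

-- An instance with integer (natural-number) processing times.
-- Ranks and positions are 0-based: job (r , i) (r : Fin k, i : Fin m) is the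
-- job with global 1-based index r*m + i + 1, i.e. the (i+1)-th largest job of
-- rank r+1.  Processing times are nonincreasing in the global index.
record Instance : Set where
  field
    k    : ℕ
    m    : ℕ
    k≥1  : 1 ≤ k
    m≥1  : 1 ≤ m
    p    : Fin k → Fin m → ℕ
    sorted : ∀ (r r′ : Fin k) (i i′ : Fin m) →
             toℕ r * m + toℕ i ≤ toℕ r′ * m + toℕ i′ → p r′ i′ ≤ p r i

open Instance public

-- A flowtime-optimal schedule: for every rank r a bijection between machines
-- and the jobs of rank r; (σ r ⟨$⟩ʳ j) is the position within rank r of the
-- job of rank r processed on machine j.  (The processing order on a machine is
-- forced, and does not affect completion times.)
Schedule : Instance → Set
Schedule P = Fin (k P) → Permutation′ (m P)

load : (P : Instance) → Schedule P → Fin (m P) → ℕ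
load P σ j = sumFin (k P) (λ r → p P r (σ r ⟨$⟩ʳ j))

makespan : (P : Instance) → Schedule P → ℕ
makespan P σ = maxFin (m P) (load P σ)

partialLoad : (P : Instance) → Schedule P → ℕ → Fin (m P) → ℕ
partialLoad P σ s j =
  sumFin (k P) (λ r → if toℕ r <ᵇ s then p P r (σ r ⟨$⟩ʳ j) else 0)

-- LD schedule: when rank r is handled (ranks in order 1..k), with current
-- loads partialLoad P σ (toℕ r), jobs of the rank are matched to machines so
-- that a larger job never goes to a machine of strictly larger current load
-- than a smaller job (largest job ↦ least loaded machine, ..., ties arbitrary).
IsLD : (P : Instance) → Schedule P → Set
IsLD P σ = ∀ (r : Fin (k P)) (i i′ : Fin (m P)) → p P r i′ < p P r i →
           partialLoad P σ (toℕ r) (σ r ⟨$⟩ˡ i) ≤ partialLoad P σ (toℕ r) (σ r ⟨$⟩ˡ i′)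

IsOptMakespan : Instance → ℕ → Set
IsOptMakespan P t = (∃[ σ ] makespan P σ ≡ t) × (∀ σ → t ≤ makespan P σ)

IsLDMakespan : Instance → ℕ → Set
IsLDMakespan P t =
  (∃[ σ ] IsLD P σ × makespan P σ ≡ t) × (∀ σ → IsLD P σ → makespan P σ ≤ t)

Counterexample : Instance → Set
Counterexample P = ∃[ σ ] ∃[ t ] IsLD P σ × IsOptMakespan P t ×
  (5 * m P ∸ 2) * t < (4 * m P ∸ 1) * makespan P σ

Rectangular : (P : Instance) → Schedule P → Set
Rectangular P σ = ∀ j j′ → load P σ j ≡ load P σ j′

-- Types (all instances here have integer data)
TypeI : Instance → Set
TypeI P = ⊤

TypeR : Instance → Set
TypeR P = ∃[ σ ] ∃[ t ] IsOptMakespan P t × makespan P σ ≡ t × Rectangular P σ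

TypeIR : Instance → Set
TypeIR P = TypeI P × TypeR P

nonzeroJobs : Instance → ℕ
nonzeroJobs P = sumFin (k P) (λ r → sumFin (m P) (λ i → if p P r i ≡ᵇ 0 then 0 else 1))

totalTime : Instance → ℕ
totalTime P = sumFin (k P) (λ r → sumFin (m P) (λ i → p P r i))

-- approximation ratio of P₂ (tLD₂/t₂) compared with that of P₁ (tLD₁/t₁),
-- by cross multiplication (t* > 0 for counterexamples)
RatioGreater : Instance → Instance → Set
RatioGreater P₂ P₁ = ∃[ a₁ ] ∃[ b₁ ] ∃[ a₂ ] ∃[ b₂ ]
  IsLDMakespan P₁ a₁ × IsOptMakespan P₁ b₁ × IsLDMakespan P₂ a₂ × IsOptMakespan P₂ b₂ ×
  a₁ * b₂ < a₂ * b₁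

RatioEqual : Instance → Instance → Set
RatioEqual P₂ P₁ = ∃[ a₁ ] ∃[ b₁ ] ∃[ a₂ ] ∃[ b₂ ]
  IsLDMakespan P₁ a₁ × IsOptMakespan P₁ b₁ × IsLDMakespan P₂ a₂ × IsOptMakespan P₂ b₂ ×
  a₁ * b₂ ≡ a₂ * b₁

-- "P₂ is smaller than P₁" (clauses (i)–(v); (v) applies since both
-- types considered, I and IR, require integer data)
Smaller : Instance → Instance → Set
Smaller P₂ P₁ =
  k P₂ < k P₁
  ⊎ (k P₂ ≡ k P₁ × m P₂ < m P₁)
  ⊎ (k P₂ ≡ k P₁ × m P₂ ≡ m P₁ × nonzeroJobs P₂ < nonzeroJobs P₁)
  ⊎ (k P₂ ≡ k P₁ × m P₂ ≡ m P₁ × nonzeroJobs P₂ ≡ nonzeroJobs P₁ × RatioGreater P₂ P₁)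
  ⊎ (k P₂ ≡ k P₁ × m P₂ ≡ m P₁ × nonzeroJobs P₂ ≡ nonzeroJobs P₁ × RatioEqual P₂ P₁ ×
     totalTime P₂ < totalTime P₁)

MinimalCounterexample : (Instance → Set) → Instance → Set
MinimalCounterexample T P =
  T P × Counterexample P × (∀ P₂ → T P₂ → Counterexample P₂ → ¬ Smaller P₂ P)

{-# OPTIONS --safe #-}

-- Suppose t_LD / t* ≥ k/(k-1) in a minimal counterexample.  Its last rank contains a
-- nonzero job, as otherwise that rank could be dropped, so all jobs of the other ranks
-- are nonzero.  Fix an optimal schedule.  Lower every nonzero job by 1, except that in
-- rank 1 only the jobs on machines whose last-rank job is 0 are lowered: every machine of
-- the optimal schedule loses exactly k-1, so t* drops by at least k-1 and a rectangular
-- schedule stays rectangular.  The sorted vector of LD loads is monotone in the processing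
-- times and loses at most 1 per rank, so t_LD drops by at most k.  Hence the ratio does
-- not decrease, while the total processing time does, contradicting minimality.
module Submission where

open import Defs
import Algebra.Properties.CommutativeMonoid.Sum
open import Data.Bool using (if_then_else_; true; false)
open import Data.Empty using (⊥)
open import Data.Fin using (Fin; zero; suc; toℕ; fromℕ; fromℕ<; inject₁; inject≤; pinch)
open import Data.Fin.Permutation using (Permutation′; _⟨$⟩ʳ_; _⟨$⟩ˡ_; inverseʳ; inverseˡ; transpose; lift₀; flip; _∘ₚ_)
  renaming (id to idₚ)
open import Data.Fin.Properties using (toℕ<n; toℕ-injective; toℕ-fromℕ; toℕ-fromℕ<; toℕ-inject₁; toℕ-inject≤; pigeonhole; any?)
open import Data.Nat using (ℕ; zero; suc; _+_; _*_; _∸_; _≤_; _<_; _⊔_; _<ᵇ_; _≡ᵇ_; z≤n; s≤s; s≤s⁻¹; _≤?_)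
open import Data.Nat.Properties
open import Data.Nat.Tactic.RingSolver using (solve-∀)
open import Data.Product using (Σ; Σ-syntax; ∃-syntax; _×_; _,_; proj₁; proj₂)
open import Data.Sum using (_⊎_; inj₁; inj₂)
open import Data.Unit using (tt)
open import Function using (_∘_)
open import Level using (0ℓ)
open import Relation.Binary using (Rel; Total; Transitive; tri<; tri≈; tri>)
open import Relation.Binary.PropositionalEquality
open import Relation.Nullary using (¬_; yes; no; contradiction)

-- Finite sums and maxima.

private module Sum = Algebra.Properties.CommutativeMonoid.Sum +-0-commutativeMonoid

sumFin≡sum : ∀ n (f : Fin n → ℕ) → sumFin n f ≡ Sum.sum f
sumFin≡sum zero    f = refl
sumFin≡sum (suc n) f = cong (f zero +_) (sumFin≡sum n (f ∘ suc))

sumFin-cong : ∀ n {f g : Fin n → ℕ} → (∀ i → f i ≡ g i) → sumFin n f ≡ sumFin n g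
sumFin-cong zero    f≗g = refl
sumFin-cong (suc n) f≗g = cong₂ _+_ (f≗g zero) (sumFin-cong n (f≗g ∘ suc))

sumFin-zero : ∀ n → sumFin n (λ _ → 0) ≡ 0
sumFin-zero zero    = refl
sumFin-zero (suc n) = sumFin-zero n

sumFin-mono-≤ : ∀ n {f g : Fin n → ℕ} → (∀ i → f i ≤ g i) → sumFin n f ≤ sumFin n g
sumFin-mono-≤ zero    f≤g = z≤n
sumFin-mono-≤ (suc n) f≤g = +-mono-≤ (f≤g zero) (sumFin-mono-≤ n (f≤g ∘ suc))

sumFin-mono-< : ∀ n {f g : Fin n → ℕ} → (∀ i → f i ≤ g i) → ∀ i → f i < g i → sumFin n f < sumFin n g
sumFin-mono-< (suc n) f≤g zero    fᵢ<gᵢ = +-mono-<-≤ fᵢ<gᵢ (sumFin-mono-≤ n (f≤g ∘ suc))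
sumFin-mono-< (suc n) f≤g (suc i) fᵢ<gᵢ = +-mono-≤-< (f≤g zero) (sumFin-mono-< n (f≤g ∘ suc) i fᵢ<gᵢ)

n≤sumFin : ∀ n {f : Fin n → ℕ} → (∀ i → 1 ≤ f i) → n ≤ sumFin n f
n≤sumFin zero    1≤f = z≤n
n≤sumFin (suc n) 1≤f = +-mono-≤ (1≤f zero) (n≤sumFin n (1≤f ∘ suc))

sumFin-init-last : ∀ n (f : Fin (suc n) → ℕ) → sumFin (suc n) f ≡ sumFin n (f ∘ inject₁) + f (fromℕ n)
sumFin-init-last n f = begin
  sumFin (suc n) f                        ≡⟨ sumFin≡sum (suc n) f ⟩
  Sum.sum f                               ≡⟨ Sum.sum-init-last f ⟩
  Sum.sum (f ∘ inject₁) + f (fromℕ n)     ≡⟨ cong (_+ f (fromℕ n)) (sumFin≡sum n (f ∘ inject₁)) ⟨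
  sumFin n (f ∘ inject₁) + f (fromℕ n)    ∎
  where open ≡-Reasoning

sumFin-permute : ∀ n (f : Fin n → ℕ) (π : Permutation′ n) → sumFin n (λ i → f (π ⟨$⟩ʳ i)) ≡ sumFin n f
sumFin-permute n f π = begin
  sumFin n (λ i → f (π ⟨$⟩ʳ i))  ≡⟨ sumFin≡sum n _ ⟩
  Sum.sum (λ i → f (π ⟨$⟩ʳ i))   ≡⟨ Sum.sum-permute f π ⟨
  Sum.sum f                      ≡⟨ sumFin≡sum n f ⟨
  sumFin n f                     ∎
  where open ≡-Reasoning

sumFin-comm : ∀ m n (f : Fin m → Fin n → ℕ) →
              sumFin m (λ i → sumFin n (f i)) ≡ sumFin n (λ j → sumFin m (λ i → f i j))
sumFin-comm m n f = begin
  sumFin m (λ i → sumFin n (f i))             ≡⟨ sumFin-cong m (λ i → sumFin≡sum n (f i)) ⟩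
  sumFin m (λ i → Sum.sum (f i))              ≡⟨ sumFin≡sum m _ ⟩
  Sum.sum (λ i → Sum.sum (f i))               ≡⟨ Sum.∑-comm f ⟩
  Sum.sum (λ j → Sum.sum (λ i → f i j))       ≡⟨ sumFin≡sum n _ ⟨
  sumFin n (λ j → Sum.sum (λ i → f i j))      ≡⟨ sumFin-cong n (λ j → sumFin≡sum m (λ i → f i j)) ⟨
  sumFin n (λ j → sumFin m (λ i → f i j))     ∎
  where open ≡-Reasoning

≤maxFin : ∀ n (f : Fin n → ℕ) i → f i ≤ maxFin n f
≤maxFin (suc n) f zero    = m≤m⊔n _ _
≤maxFin (suc n) f (suc i) = ≤-trans (≤maxFin n (f ∘ suc) i) (m≤n⊔m _ _)

maxFin-lub : ∀ n {f : Fin n → ℕ} {x} → (∀ i → f i ≤ x) → maxFin n f ≤ x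
maxFin-lub zero    f≤x = z≤n
maxFin-lub (suc n) f≤x = ⊔-lub (f≤x zero) (maxFin-lub n (f≤x ∘ suc))

maxFin-cong : ∀ n {f g : Fin n → ℕ} → (∀ i → f i ≡ g i) → maxFin n f ≡ maxFin n g
maxFin-cong zero    f≗g = refl
maxFin-cong (suc n) f≗g = cong₂ _⊔_ (f≗g zero) (maxFin-cong n (f≗g ∘ suc))

-- Sorting along a total preorder.

module _ {A : Set} {_≼_ : Rel A 0ℓ} (total : Total _≼_) (≼-trans : Transitive _≼_) where

  ≼-refl : ∀ {x} → x ≼ x
  ≼-refl {x} with total x x
  ... | inj₁ x≼x = x≼x
  ... | inj₂ x≼x = x≼x

  minimum : ∀ n (f : Fin (suc n) → A) → ∃[ j ] (∀ i → f j ≼ f i)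
  minimum zero    f = zero , λ { zero → ≼-refl }
  minimum (suc n) f with minimum n (f ∘ suc)
  ... | j , min with total (f zero) (f (suc j))
  ... | inj₁ f₀≼fⱼ = zero  , λ { zero → ≼-refl ; (suc i) → ≼-trans f₀≼fⱼ (min i) }
  ... | inj₂ fⱼ≼f₀ = suc j , λ { zero → fⱼ≼f₀ ; (suc i) → min i }

  -- Selection sort: a minimum is swapped to the front and the rest is sorted recursively. It works
  -- with preorders because the order used in `ld-order` has ties.
  sort : ∀ n (f : Fin n → A) →
         Σ[ π ∈ Permutation′ n ] (∀ i j → toℕ i ≤ toℕ j → f (π ⟨$⟩ʳ i) ≼ f (π ⟨$⟩ʳ j))
  sort zero    f = idₚ , λ ()
  sort (suc n) f with minimum n f
  ... | j , min with sort n (λ i → f (transpose zero j ⟨$⟩ʳ suc i))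
  ... | π , sorted = lift₀ π ∘ₚ transpose zero j , λ
    { zero    i′       _         → min _
    ; (suc i) (suc i′) (s≤s i≤i′) → sorted i i′ i≤i′
    }

-- Comparing sorted sequences.

Ascending Descending : ∀ {m} → (Fin m → ℕ) → Set
Ascending  f = ∀ i j → toℕ i ≤ toℕ j → f i ≤ f j
Descending f = ∀ i j → toℕ i ≤ toℕ j → f j ≤ f i

-- Pigeonhole: ρ⁻¹ cannot map the i+1 positions up to i into the i positions before i.
permutation-crosses : ∀ {m} (ρ : Permutation′ m) i → ∃[ j ] toℕ i ≤ toℕ j × toℕ (ρ ⟨$⟩ʳ j) ≤ toℕ i
permutation-crosses {m} ρ i with any? (λ l → toℕ i ≤? toℕ (ρ ⟨$⟩ˡ embed l))
  where
  embed : Fin (suc (toℕ i)) → Fin m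
  embed l = inject≤ l (toℕ<n i)
... | yes (l , i≤) = _ , i≤ , (begin
  toℕ (ρ ⟨$⟩ʳ (ρ ⟨$⟩ˡ inject≤ l (toℕ<n i)))  ≡⟨ cong toℕ (inverseʳ ρ) ⟩
  toℕ (inject≤ l (toℕ<n i))                  ≡⟨ toℕ-inject≤ l (toℕ<n i) ⟩
  toℕ l                                      ≤⟨ s≤s⁻¹ (toℕ<n l) ⟩
  toℕ i                                      ∎)
  where open ≤-Reasoning
... | no  ¬any with pigeonhole (n<1+n (toℕ i)) (λ l → fromℕ< (≰⇒> (λ i≤ → ¬any (l , i≤))))
...   | l , l′ , l<l′ , eq = contradiction l≡l′ (<⇒≢ l<l′)
  where
  l≡l′ : toℕ l ≡ toℕ l′
  l≡l′ = begin
    toℕ l                        ≡⟨ toℕ-inject≤ l (toℕ<n i) ⟨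
    toℕ (inject≤ l (toℕ<n i))    ≡⟨ cong toℕ (inverseʳ ρ) ⟨
    toℕ (ρ ⟨$⟩ʳ (ρ ⟨$⟩ˡ inject≤ l (toℕ<n i)))
      ≡⟨ cong (λ x → toℕ (ρ ⟨$⟩ʳ x)) (toℕ-injective (trans (sym (toℕ-fromℕ< _)) (trans (cong toℕ eq) (toℕ-fromℕ< _)))) ⟩
    toℕ (ρ ⟨$⟩ʳ (ρ ⟨$⟩ˡ inject≤ l′ (toℕ<n i)))  ≡⟨ cong toℕ (inverseʳ ρ) ⟩
    toℕ (inject≤ l′ (toℕ<n i))   ≡⟨ toℕ-inject≤ l′ (toℕ<n i) ⟩
    toℕ l′                       ∎
    where open ≡-Reasoning

-- Domination along any matching survives sorting: some `j` at or after `i` is matched to a position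
-- at or before `i`, and then `f i ≤ f j ≤ g (ρ j) + c ≤ g i + c`.
ascending-dominated : ∀ {m} {f g : Fin m → ℕ} {c} (ρ : Permutation′ m) → Ascending f → Ascending g →
                      (∀ i → f i ≤ g (ρ ⟨$⟩ʳ i) + c) → ∀ i → f i ≤ g i + c
ascending-dominated {c = c} ρ f↗ g↗ f≤g i with permutation-crosses ρ i
... | j , i≤j , ρj≤i = ≤-trans (f↗ i j i≤j) (≤-trans (f≤g j) (+-monoˡ-≤ c (g↗ _ i ρj≤i)))

-- Same argument with the inverse matching: `f i ≤ f (ρ⁻¹ j) ≤ g j + c ≤ g i + c` for some `j` at or
-- after `i` whose preimage lies at or before `i`.
descending-dominated : ∀ {m} {f g : Fin m → ℕ} {c} (ρ : Permutation′ m) → Descending f → Descending g →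
                       (∀ i → f i ≤ g (ρ ⟨$⟩ʳ i) + c) → ∀ i → f i ≤ g i + c
descending-dominated {f = f} {g} {c} ρ f↘ g↘ f≤g i with permutation-crosses (flip ρ) i
... | j , i≤j , ρ⁻¹j≤i = ≤-trans (f↘ _ i ρ⁻¹j≤i) (≤-trans (f≤g (ρ ⟨$⟩ˡ j))
      (subst (λ x → g x + c ≤ g i + c) (sym (inverseʳ ρ)) (+-monoˡ-≤ c (g↘ i j i≤j))))

-- LD schedules under small changes of the processing times.

partialSum : ∀ {m} k → (Fin k → Fin m → ℕ) → (Fin k → Permutation′ m) → ℕ → Fin m → ℕ
partialSum k p σ s j = sumFin k (λ r → if toℕ r <ᵇ s then p r (σ r ⟨$⟩ʳ j) else 0)

-- The condition IsLD for machines that already carry the loads b; this makes it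
-- amenable to induction on the ranks from the largest one.
LDFrom : ∀ {m} k → (Fin m → ℕ) → (Fin k → Fin m → ℕ) → (Fin k → Permutation′ m) → Set
LDFrom k b p σ = ∀ r i i′ → p r i′ < p r i →
  b (σ r ⟨$⟩ˡ i) + partialSum k p σ (toℕ r) (σ r ⟨$⟩ˡ i) ≤ b (σ r ⟨$⟩ˡ i′) + partialSum k p σ (toℕ r) (σ r ⟨$⟩ˡ i′)

module _ {m} {a x : Fin m → ℕ} (σ : Permutation′ m)
         (ld : ∀ i i′ → x i′ < x i → a (σ ⟨$⟩ˡ i) ≤ a (σ ⟨$⟩ˡ i′)) where

  private
    -- Total because of ld: machines getting jobs of different size are ordered by ld,
    -- the others by their loads.
    _≼_ : Rel (Fin m) 0ℓ
    j ≼ j′ = a j ≤ a j′ × x (σ ⟨$⟩ʳ j′) ≤ x (σ ⟨$⟩ʳ j)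

    ld′ : ∀ j j′ → x (σ ⟨$⟩ʳ j′) < x (σ ⟨$⟩ʳ j) → a j ≤ a j′
    ld′ j j′ lt = subst₂ (λ y z → a y ≤ a z) (inverseˡ σ) (inverseˡ σ) (ld _ _ lt)

    ≼-total : Total _≼_
    ≼-total j j′ with <-cmp (x (σ ⟨$⟩ʳ j)) (x (σ ⟨$⟩ʳ j′))
    ... | tri< lt _ _ = inj₂ (ld′ j′ j lt , <⇒≤ lt)
    ... | tri> _ _ gt = inj₁ (ld′ j j′ gt , <⇒≤ gt)
    ... | tri≈ _ eq _ with ≤-total (a j) (a j′)
    ...   | inj₁ a≤ = inj₁ (a≤ , ≤-reflexive (sym eq))
    ...   | inj₂ a≥ = inj₂ (a≥ , ≤-reflexive eq)

  -- A single order of the machines sorts the loads and the new jobs at once, so that both can be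
  -- compared position by position with those of another LD schedule.
  ld-order : Σ[ α ∈ Permutation′ m ] Ascending (λ i → a (α ⟨$⟩ʳ i)) × Descending (λ i → x (σ ⟨$⟩ʳ (α ⟨$⟩ʳ i)))
  ld-order with sort {_≼_ = _≼_} ≼-total (λ { (u , v) (u′ , v′) → ≤-trans u u′ , ≤-trans v′ v }) m (λ j → j)
  ... | α , sorted = α , (λ i j i≤j → proj₁ (sorted i j i≤j)) , (λ i j i≤j → proj₂ (sorted i j i≤j))

shift-≤ : ∀ {u v x y} c → u ≤ v + c → x ≤ y + 1 → u + x ≤ v + y + suc c
shift-≤ {u} {v} {x} {y} c u≤ x≤ = begin
  u + x              ≤⟨ +-mono-≤ u≤ x≤ ⟩
  (v + c) + (y + 1)  ≡⟨ +-assoc v c (y + 1) ⟩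
  v + (c + (y + 1))  ≡⟨ cong (v +_) (+-comm c (y + 1)) ⟩
  v + (y + 1 + c)    ≡⟨ cong (v +_) (+-assoc y 1 c) ⟩
  v + (y + suc c)    ≡⟨ +-assoc v y (suc c) ⟨
  v + y + suc c      ∎
  where open ≤-Reasoning

-- Once the machines are sorted by load, a and b as well as the current ranks of p and q are
-- comparable pointwise, so each rank adds at most 1 to the excess c.
ld-dominated : ∀ {m} k {p q : Fin k → Fin m → ℕ} (σ : Fin k → Permutation′ m) {a b : Fin m → ℕ} {c}
               (π : Permutation′ m) → (∀ r → Descending (p r)) → (∀ r → Descending (q r)) →
               (∀ r i → p r i ≤ q r i + 1) →
               (∀ j → a j ≤ b (π ⟨$⟩ʳ j) + c) → LDFrom k a p σ →
               Σ[ τ ∈ (Fin k → Permutation′ m) ] LDFrom k b q τ × Σ[ ρ ∈ Permutation′ m ] (∀ j →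
                 a j + sumFin k (λ r → p r (σ r ⟨$⟩ʳ j)) ≤
                 b (ρ ⟨$⟩ʳ j) + sumFin k (λ r → q r (τ r ⟨$⟩ʳ (ρ ⟨$⟩ʳ j))) + (c + k))
ld-dominated zero σ {a} {b} {c} π p↘ q↘ p≤q a≤b ld = (λ ()) , (λ ()) , π ,
  λ j → subst₂ _≤_ (sym (+-identityʳ (a j)))
          (sym (cong₂ _+_ (+-identityʳ (b (π ⟨$⟩ʳ j))) (+-identityʳ c))) (a≤b j)
ld-dominated {m} (suc k) {p} {q} σ {a} {b} {c} π p↘ q↘ p≤q a≤b ld
  with ld-order {a = a} {p zero} (σ zero) (λ i i′ lt → subst₂ _≤_ (no-load i) (no-load i′) (ld zero i i′ lt))
     | sort {_≼_ = _≤_} ≤-total ≤-trans m b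
  where
  no-load : ∀ i → a (σ zero ⟨$⟩ˡ i) + partialSum (suc k) p σ 0 (σ zero ⟨$⟩ˡ i) ≡ a (σ zero ⟨$⟩ˡ i)
  no-load i = trans (cong (a (σ zero ⟨$⟩ˡ i) +_) (sumFin-zero k)) (+-identityʳ _)
... | α , a↗ , x↘ | β , b↗ = τ⁺ , ldτ⁺ , ρ , bound
  where
  a⁺ b⁺ : Fin m → ℕ
  a⁺ j = a j + p zero (σ zero ⟨$⟩ʳ j)
  b⁺ j = b j + q zero (β ⟨$⟩ˡ j)

  a≤b-sorted : ∀ i → a (α ⟨$⟩ʳ i) ≤ b (β ⟨$⟩ʳ i) + c
  -- The matching `π` of machines is rewritten as a matching between positions in the two sorted
  -- orders.
  a≤b-sorted = ascending-dominated (α ∘ₚ π ∘ₚ flip β) a↗ b↗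
    (λ i → subst (λ z → a (α ⟨$⟩ʳ i) ≤ b z + c) (sym (inverseʳ β)) (a≤b (α ⟨$⟩ʳ i)))

  p≤q-sorted : ∀ i → p zero (σ zero ⟨$⟩ʳ (α ⟨$⟩ʳ i)) ≤ q zero i + 1
  p≤q-sorted = descending-dominated (α ∘ₚ σ zero) x↘ (q↘ zero) (λ i → p≤q zero _)

  -- From here on machines at equal positions of the orders `α` and `β` are matched.
  a⁺≤b⁺ : ∀ j → a⁺ j ≤ b⁺ (flip α ∘ₚ β ⟨$⟩ʳ j) + suc c
  a⁺≤b⁺ j = shift-≤ {v = b (β ⟨$⟩ʳ (α ⟨$⟩ˡ j))} c
    (subst (λ z → a z ≤ b (β ⟨$⟩ʳ (α ⟨$⟩ˡ j)) + c) (inverseʳ α) (a≤b-sorted (α ⟨$⟩ˡ j)))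
    (subst₂ (λ y z → p zero (σ zero ⟨$⟩ʳ y) ≤ q zero z + 1) (inverseʳ α) (sym (inverseˡ β)) (p≤q-sorted (α ⟨$⟩ˡ j)))

  rec : Σ[ τ ∈ (Fin k → Permutation′ m) ] LDFrom k b⁺ (q ∘ suc) τ × Σ[ ρ ∈ Permutation′ m ] (∀ j →
          a⁺ j + sumFin k (λ r → p (suc r) (σ (suc r) ⟨$⟩ʳ j)) ≤
          b⁺ (ρ ⟨$⟩ʳ j) + sumFin k (λ r → q (suc r) (τ r ⟨$⟩ʳ (ρ ⟨$⟩ʳ j))) + (suc c + k))
  -- The rank just handled is absorbed into the initial loads `a⁺` and `b⁺`.
  rec = ld-dominated k (σ ∘ suc) {a⁺} {b⁺} (flip α ∘ₚ β) (p↘ ∘ suc) (q↘ ∘ suc) (p≤q ∘ suc) a⁺≤b⁺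
    (λ r i i′ lt → subst₂ _≤_ (sym (+-assoc (a _) _ _)) (sym (+-assoc (a _) _ _)) (ld (suc r) i i′ lt))

  τ = proj₁ rec
  ρ = proj₁ (proj₂ (proj₂ rec))

  τ⁺ : Fin (suc k) → Permutation′ m
  -- `β` lists the machines by increasing load and `q zero` is descending, so the inverse of `β`
  -- gives the largest job to the least loaded machine, and so on.
  τ⁺ zero    = flip β
  τ⁺ (suc r) = τ r

  ldτ⁺ : LDFrom (suc k) b q τ⁺
  ldτ⁺ zero    i i′ lt = +-mono-≤ (b↗ i i′ (≮⇒≥ (λ i′<i → <⇒≱ lt (q↘ zero i′ i (<⇒≤ i′<i)))))
    (≤-reflexive (trans (sumFin-zero (suc k)) (sym (sumFin-zero (suc k)))))
  ldτ⁺ (suc r) i i′ lt = subst₂ _≤_ (+-assoc (b _) _ _) (+-assoc (b _) _ _) (proj₁ (proj₂ rec) r i i′ lt)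

  bound : ∀ j → a j + sumFin (suc k) (λ r → p r (σ r ⟨$⟩ʳ j)) ≤
                b (ρ ⟨$⟩ʳ j) + sumFin (suc k) (λ r → q r (τ⁺ r ⟨$⟩ʳ (ρ ⟨$⟩ʳ j))) + (c + suc k)
  bound j = subst₂ _≤_ (+-assoc (a j) _ _)
    (cong₂ _+_ (+-assoc (b (ρ ⟨$⟩ʳ j)) _ _) (sym (+-suc c k))) (proj₂ (proj₂ (proj₂ rec)) j)

-- The loss of a machine whose jobs are lowered.

-- 1 ∸ (1 ∸ n) is 0 for n = 0 and 1 otherwise.
n≡n∸1+sgn : ∀ n → n ≡ (n ∸ 1) + (1 ∸ (1 ∸ n))
n≡n∸1+sgn zero    = refl
n≡n∸1+sgn (suc n) = sym (trans (cong (λ z → n + (1 ∸ z)) (0∸n≡0 n)) (+-comm n 1))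

-- Only the last entry can be 0 and thus escape the truncated subtraction, so the loss is `n`, plus
-- one if the last entry is nonzero.
sumFin-pred : ∀ n (x : Fin (suc n) → ℕ) → (∀ r → 1 ≤ x (inject₁ r)) →
              sumFin (suc n) x ≡ sumFin (suc n) (λ r → x r ∸ 1) + (n + (1 ∸ (1 ∸ x (fromℕ n))))
sumFin-pred zero    x x≥1 = begin
  x zero + 0                                     ≡⟨ +-identityʳ _ ⟩
  x zero                                         ≡⟨ n≡n∸1+sgn (x zero) ⟩
  (x zero ∸ 1) + (1 ∸ (1 ∸ x zero))              ≡⟨ cong (_+ (1 ∸ (1 ∸ x zero))) (+-identityʳ _) ⟨
  (x zero ∸ 1 + 0) + (1 ∸ (1 ∸ x zero))          ∎
  where open ≡-Reasoning
sumFin-pred (suc n) x x≥1 = begin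
  x zero + sumFin (suc n) (x ∘ suc)
    ≡⟨ cong₂ _+_ (sym (m∸n+n≡m (x≥1 zero))) (sumFin-pred n (x ∘ suc) (x≥1 ∘ suc)) ⟩
  (x zero ∸ 1 + 1) + (S + (n + e))
    ≡⟨ rearrange (x zero ∸ 1) S n e ⟩
  (x zero ∸ 1 + S) + (suc n + e) ∎
  where
  open ≡-Reasoning
  S = sumFin (suc n) (λ r → x (suc r) ∸ 1)
  e = 1 ∸ (1 ∸ x (fromℕ (suc n)))
  rearrange : ∀ u s n e → (u + 1) + (s + (n + e)) ≡ (u + s) + (suc n + e)
  rearrange = solve-∀

-- The first entry is lowered exactly when the last one is 0 and so contributes no loss. Hence the
-- loss is the number of entries minus one in either case.
sumFin-decrease : ∀ n (x : Fin (suc (suc n)) → ℕ) → (∀ r → 1 ≤ x (inject₁ r)) →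
  sumFin (suc (suc n)) x ≡
  (x zero ∸ (1 ∸ x (fromℕ (suc n)))) + sumFin (suc n) (λ r → x (suc r) ∸ 1) + suc n
sumFin-decrease n x x≥1 = begin
  x zero + sumFin (suc n) (x ∘ suc)
    ≡⟨ cong₂ _+_ (sym (m∸n+n≡m (≤-trans z≤1 (x≥1 zero)))) (sumFin-pred n (x ∘ suc) (x≥1 ∘ suc)) ⟩
  (x zero ∸ z + z) + (S + (n + (1 ∸ z)))
    ≡⟨ rearrange (x zero ∸ z) z S n (1 ∸ z) ⟩
  (x zero ∸ z + S) + (n + (z + (1 ∸ z)))
    ≡⟨ cong (λ w → x zero ∸ z + S + (n + w)) (m+[n∸m]≡n z≤1) ⟩
  (x zero ∸ z + S) + (n + 1)
    ≡⟨ cong (x zero ∸ z + S +_) (+-comm n 1) ⟩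
  (x zero ∸ z + S) + suc n ∎
  where
  open ≡-Reasoning
  z = 1 ∸ x (fromℕ (suc n))
  S = sumFin (suc n) (λ r → x (suc r) ∸ 1)
  z≤1 : z ≤ 1
  z≤1 = m∸n≤m 1 (x (fromℕ (suc n)))
  rearrange : ∀ u z s n e → (u + z) + (s + (n + e)) ≡ (u + s) + (n + (z + e))
  rearrange = solve-∀

-- Optimal makespans and largest LD makespans.

¬¬argmin : ∀ {A : Set} (μ : A → ℕ) n a → μ a ≤ n → ¬ ¬ (∃[ a ] (∀ b → μ a ≤ μ b))
¬¬argmin μ zero    a μa≤0 ¬min = ¬min (a , λ b → ≤-trans μa≤0 z≤n)
-- A candidate that is not minimal yields one of smaller value, which can happen only as often as
-- the bound allows.
¬¬argmin μ (suc n) a μa≤ ¬min  = ¬min (a , λ b → ≮⇒≥ (λ μb<μa →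
  ¬¬argmin μ n b (s≤s⁻¹ (≤-trans μb<μa μa≤)) ¬min))

-- Double negation suffices, as the optimum only serves to derive `⊥`; this avoids an enumeration of
-- the schedules.
¬¬IsOptMakespan : ∀ P → ¬ ¬ (∃[ t ] IsOptMakespan P t)
¬¬IsOptMakespan P ¬opt = ¬¬argmin (makespan P) _ (λ _ → idₚ) ≤-refl
  λ (σ , min) → ¬opt (makespan P σ , (σ , refl) , min)

makespan-bound : ∀ P σ → makespan P σ ≤ sumFin (k P) (λ r → maxFin (m P) (p P r))
makespan-bound P σ = maxFin-lub (m P) (λ j → sumFin-mono-≤ (k P) (λ r → ≤maxFin (m P) (p P r) _))

¬¬IsLDMakespan : ∀ P σ → IsLD P σ → ¬ ¬ (∃[ t ] IsLDMakespan P t)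
-- The maximum is found as a minimum of `B ∸ makespan`; `B` bounds all makespans, so truncation
-- loses nothing.
¬¬IsLDMakespan P σ ld ¬max = ¬¬argmin {Σ (Schedule P) (IsLD P)} (λ (τ , _) → B ∸ makespan P τ) _ (σ , ld) ≤-refl
  λ ((τ , ldτ) , min) → ¬max (makespan P τ , (τ , ldτ , refl) ,
    λ ρ ldρ → ∸-cancelʳ-≤ (makespan-bound P ρ) (min (ρ , ldρ)))
  where B = sumFin (k P) (λ r → maxFin (m P) (p P r))

IsOptMakespan-unique : ∀ P {t t′} → IsOptMakespan P t → IsOptMakespan P t′ → t ≡ t′
IsOptMakespan-unique P ((σ , refl) , min) ((σ′ , refl) , min′) = ≤-antisym (min σ′) (min′ σ)

sumFin-load : ∀ P σ → sumFin (m P) (load P σ) ≡ totalTime P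
sumFin-load P σ = trans (sym (sumFin-comm (k P) (m P) (λ r j → p P r (σ r ⟨$⟩ʳ j))))
  (sumFin-cong (k P) (λ r → sumFin-permute (m P) (p P r) (σ r)))

-- A schedule of smaller makespan would have every load below the common load of `σ`, although both
-- families of loads sum to `totalTime P`.
rectangular⇒optimal : ∀ P σ → Rectangular P σ → IsOptMakespan P (makespan P σ)
rectangular⇒optimal P σ rect = (σ , refl) , λ τ → ≮⇒≥ λ τ<σ →
  let load< : ∀ j → load P τ j < load P σ j
      load< j = <-≤-trans (≤-<-trans (≤maxFin (m P) (load P τ) j) τ<σ)
                  (maxFin-lub (m P) (λ j′ → ≤-reflexive (rect j′ j)))
  in <-irrefl (trans (sumFin-load P τ) (sym (sumFin-load P σ)))
       (sumFin-mono-< (m P) (<⇒≤ ∘ load<) (fromℕ< (m≥1 P)) (load< _))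

-- Arithmetic of the approximation ratio.

4m∸1≤5m∸2 : ∀ m → 1 ≤ m → 4 * m ∸ 1 ≤ 5 * m ∸ 2
4m∸1≤5m∸2 m m≥1 = ∸-monoˡ-≤ 2 (+-monoˡ-≤ (4 * m) m≥1)

-- Weak inequalities for the nonzero jobs and the ratio suffice: a strict one gives clause (iii) or
-- (iv), and two equalities leave clause (v) to the strict drop in total time.
Smaller-intro : ∀ Q P a t a′ t′ → k Q ≡ k P → m Q ≡ m P →
  nonzeroJobs Q ≤ nonzeroJobs P → totalTime Q < totalTime P →
  IsLDMakespan P a → IsOptMakespan P t → IsLDMakespan Q a′ → IsOptMakespan Q t′ →
  a * t′ ≤ a′ * t → Smaller Q P
Smaller-intro Q P a t a′ t′ k≡ m≡ jobs≤ time< a-LD t-opt a′-LD t′-opt ratio≤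
  with m≤n⇒m<n∨m≡n jobs≤ | m≤n⇒m<n∨m≡n ratio≤
... | inj₁ jobs< | _           = inj₂ (inj₂ (inj₁ (k≡ , m≡ , jobs<)))
... | inj₂ jobs≡ | inj₁ ratio< = inj₂ (inj₂ (inj₂ (inj₁ (k≡ , m≡ , jobs≡ ,
        (a , t , a′ , t′ , a-LD , t-opt , a′-LD , t′-opt , ratio<)))))
... | inj₂ jobs≡ | inj₂ ratio≡ = inj₂ (inj₂ (inj₂ (inj₂ (k≡ , m≡ , jobs≡ ,
        (a , t , a′ , t′ , a-LD , t-opt , a′-LD , t′-opt , ratio≡) , time<))))

-- Primes belong to the lowered instance, `n` stands for k - 1, and `ratio≥` is the negation of the
-- bound to be proved.
module _ {m a t a′ t′ n} (m≥1 : 1 ≤ m) (t′+n≤t : t′ + n ≤ t) (a≤a′+1+n : a ≤ a′ + suc n)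
         (ratio≥ : suc n * t ≤ a * n) where

  -- Mediant argument: taking `n + 1` from the numerator and `n` from the denominator cannot lower
  -- `a / t`, because `(n + 1) / n` is at most `a / t`.
  ratio-grows : a * t′ ≤ a′ * t
  ratio-grows = +-cancelʳ-≤ (a * n) _ _ (begin
    a * t′ + a * n        ≡⟨ *-distribˡ-+ a t′ n ⟨
    a * (t′ + n)          ≤⟨ *-monoʳ-≤ a t′+n≤t ⟩
    a * t                 ≤⟨ *-monoˡ-≤ t a≤a′+1+n ⟩
    (a′ + suc n) * t      ≡⟨ *-distribʳ-+ t a′ (suc n) ⟩
    a′ * t + suc n * t    ≤⟨ +-monoʳ-≤ (a′ * t) ratio≥ ⟩
    a′ * t + a * n        ∎)
    where open ≤-Reasoning

  violation-persists : suc n ≤ t → (5 * m ∸ 2) * t < (4 * m ∸ 1) * a → (5 * m ∸ 2) * t′ < (4 * m ∸ 1) * a′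
  violation-persists 1+n≤t violated = go t′ ratio-grows
    where
    -- The conjectured bound is at least 1, so violating it puts the LD makespan above the optimum.
    t<a : t < a
    t<a = *-cancelˡ-< (5 * m ∸ 2) t a (<-≤-trans violated (*-monoˡ-≤ a (4m∸1≤5m∸2 m m≥1)))

    a′>0 : 0 < a′
    a′>0 = +-cancelʳ-< (suc n) 0 a′ (≤-<-trans 1+n≤t (<-≤-trans t<a a≤a′+1+n))

    4m∸1>0 : 0 < 4 * m ∸ 1
    4m∸1>0 = ≤-trans (s≤s z≤n) (∸-monoˡ-≤ 1 (*-monoʳ-≤ 4 m≥1))

    swap : ∀ x y z → x * y * z ≡ x * z * y
    swap = solve-∀

    go : ∀ t′ → a * t′ ≤ a′ * t → (5 * m ∸ 2) * t′ < (4 * m ∸ 1) * a′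
    go zero     _ = subst (_< (4 * m ∸ 1) * a′) (sym (*-zeroʳ (5 * m ∸ 2))) (*-mono-≤ 4m∸1>0 a′>0)
    go (suc t″) at′≤a′t = *-cancelʳ-< t _ _ (begin-strict
      (5 * m ∸ 2) * suc t″ * t    ≡⟨ swap (5 * m ∸ 2) (suc t″) t ⟩
      (5 * m ∸ 2) * t * suc t″    <⟨ *-monoˡ-< (suc t″) violated ⟩
      (4 * m ∸ 1) * a * suc t″    ≡⟨ *-assoc (4 * m ∸ 1) a (suc t″) ⟩
      (4 * m ∸ 1) * (a * suc t″)  ≤⟨ *-monoʳ-≤ (4 * m ∸ 1) at′≤a′t ⟩
      (4 * m ∸ 1) * (a′ * t)      ≡⟨ *-assoc (4 * m ∸ 1) a′ t ⟨
      (4 * m ∸ 1) * a′ * t        ∎)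
      where open ≤-Reasoning

-- `σ` bounds the new optimum from above and `τ` the new LD makespan from below. Both values are
-- available only under double negation, hence the form of the conclusion.
ratio≥⇒smaller-counterexample : ∀ n a t P Q → k Q ≡ k P → m Q ≡ m P →
  nonzeroJobs Q ≤ nonzeroJobs P → totalTime Q < totalTime P →
  (σ : Schedule Q) → makespan Q σ + n ≤ t →
  Σ[ τ ∈ Schedule Q ] IsLD Q τ × a ≤ makespan Q τ + suc n →
  IsLDMakespan P a → IsOptMakespan P t → suc n ≤ t →
  (5 * m P ∸ 2) * t < (4 * m P ∸ 1) * a → suc n * t ≤ a * n →
  ¬ ¬ (Counterexample Q × Smaller Q P)
ratio≥⇒smaller-counterexample n a t P Q k≡ m≡ jobs≤ time< σ σ+n≤t (τ , ldτ , a≤τ+1+n)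
                              a-LD t-opt 1+n≤t violated ratio≥ ¬smaller =
  ¬¬IsOptMakespan Q λ (t′ , t′-opt) → ¬¬IsLDMakespan Q τ ldτ λ (a′ , a′-LD) → go t′ a′ t′-opt a′-LD
  where
  go : ∀ t′ a′ → IsOptMakespan Q t′ → IsLDMakespan Q a′ → ⊥
  go t′ a′ t′-opt@(_ , t′≤) a′-LD@((ρ , ldρ , refl) , ≤a′) = ¬smaller
    ( (ρ , t′ , ldρ , t′-opt , violation-persists (m≥1 Q) t′+n≤t a≤a′+1+n ratio≥ 1+n≤t
        (subst (λ m → (5 * m ∸ 2) * t < (4 * m ∸ 1) * a) (sym m≡) violated))
    , Smaller-intro Q P a t a′ t′ k≡ m≡ jobs≤ time< a-LD t-opt a′-LD t′-opt
        (ratio-grows (m≥1 Q) t′+n≤t a≤a′+1+n ratio≥)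
    )
    where
    t′+n≤t : t′ + n ≤ t
    t′+n≤t = ≤-trans (+-monoˡ-≤ n (t′≤ σ)) σ+n≤t
    a≤a′+1+n : a ≤ a′ + suc n
    a≤a′+1+n = ≤-trans a≤τ+1+n (+-monoˡ-≤ (suc n) (≤a′ τ ldτ))

-- The order of jobs and LD schedules of dominated instances.

rank-before : ∀ {m r r′} (i : Fin m) i′ → r < r′ → r * m + toℕ i ≤ r′ * m + i′
rank-before {m} {r} {r′} i i′ r<r′ = begin
  r * m + toℕ i  ≤⟨ +-monoʳ-≤ (r * m) (<⇒≤ (toℕ<n i)) ⟩
  r * m + m      ≡⟨ +-comm (r * m) m ⟩
  suc r * m      ≤⟨ *-monoˡ-≤ m r<r′ ⟩
  r′ * m         ≤⟨ m≤m+n (r′ * m) i′ ⟩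
  r′ * m + i′    ∎
  where open ≤-Reasoning

rank-descending : ∀ P r → Descending (p P r)
rank-descending P r i j i≤j = sorted P r r i j (+-monoʳ-≤ (toℕ r * m P) i≤j)

IsLD-dominated : ∀ P {q} q-sorted → let Q = record P { p = q ; sorted = q-sorted } in
  (∀ r i → p P r i ≤ q r i + 1) → ∀ σ → IsLD P σ →
  Σ[ τ ∈ Schedule Q ] IsLD Q τ × makespan P σ ≤ makespan Q τ + k P
IsLD-dominated P {q} q-sorted p≤q+1 σ ld =
  τ , ldτ , maxFin-lub (m P) (λ j →
    ≤-trans (load≤ j) (+-monoˡ-≤ (k P) (≤maxFin (m P) (load Q τ) (ρ ⟨$⟩ʳ j))))
  where
  Q = record P { p = q ; sorted = q-sorted }
  -- With zero initial loads, `LDFrom` computes to `IsLD`.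
  dominated = ld-dominated (k P) {p P} {q} σ {λ _ → 0} {λ _ → 0} {0} idₚ
    (rank-descending P) (rank-descending Q) p≤q+1 (λ _ → z≤n) ld
  τ = proj₁ dominated
  ldτ = proj₁ (proj₂ dominated)
  ρ = proj₁ (proj₂ (proj₂ dominated))
  load≤ = proj₂ (proj₂ (proj₂ dominated))

pinch-inject₁ : ∀ {n} (i : Fin (suc n)) → pinch (fromℕ n) (inject₁ i) ≡ i
pinch-inject₁ {zero}  zero    = refl
pinch-inject₁ {suc n} zero    = refl
pinch-inject₁ {suc n} (suc i) = cong suc (pinch-inject₁ i)

-- Instances with at least two ranks, and dropping a last rank of zeros.

module ManyRanks (n m : ℕ) (m≥1 : 1 ≤ m) (p : Fin (suc (suc n)) → Fin m → ℕ)
         (sorted : ∀ r r′ i i′ → toℕ r * m + toℕ i ≤ toℕ r′ * m + toℕ i′ → p r′ i′ ≤ p r i) where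

  P : Instance
  P = record { k = suc (suc n) ; m = m ; k≥1 = s≤s z≤n ; m≥1 = m≥1 ; p = p ; sorted = sorted }

  lastRank : Fin (suc (suc n))
  lastRank = fromℕ (suc n)

  first : Fin m
  first = fromℕ< m≥1

  ≤p-first : ∀ r i → p r i ≤ p r first
  ≤p-first r i = rank-descending P r first i (subst (_≤ toℕ i) (sym (toℕ-fromℕ< m≥1)) z≤n)

  dropLastRank : Instance
  dropLastRank = record
    { k = suc n ; m = m ; k≥1 = s≤s z≤n ; m≥1 = m≥1 ; p = p ∘ inject₁
    ; sorted = λ r r′ i i′ ri≤r′i′ → sorted (inject₁ r) (inject₁ r′) i i′
        (subst₂ (λ s s′ → s * m + toℕ i ≤ s′ * m + toℕ i′) (sym (toℕ-inject₁ r)) (sym (toℕ-inject₁ r′)) ri≤r′i′)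
    }

  module _ (p-last≡0 : ∀ i → p lastRank i ≡ 0) where

    load-dropLast : ∀ σ j → load P σ j ≡ load dropLastRank (σ ∘ inject₁) j
    load-dropLast σ j = trans (sumFin-init-last (suc n) (λ r → p r (σ r ⟨$⟩ʳ j)))
      (trans (cong (load dropLastRank (σ ∘ inject₁) j +_) (p-last≡0 (σ lastRank ⟨$⟩ʳ j))) (+-identityʳ _))

    partialLoad-dropLast : ∀ σ s j → partialLoad P σ s j ≡ partialLoad dropLastRank (σ ∘ inject₁) s j
    partialLoad-dropLast σ s j =
      trans (sumFin-init-last (suc n) (λ r → if toℕ r <ᵇ s then p r (σ r ⟨$⟩ʳ j) else 0))
        (trans (cong₂ _+_ (sumFin-cong (suc n) before-last) (if-0 (toℕ lastRank <ᵇ s))) (+-identityʳ _))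
      where
      before-last : ∀ r → (if toℕ (inject₁ r) <ᵇ s then p (inject₁ r) (σ (inject₁ r) ⟨$⟩ʳ j) else 0) ≡
                          (if toℕ r <ᵇ s then p (inject₁ r) (σ (inject₁ r) ⟨$⟩ʳ j) else 0)
      before-last r = cong (λ s′ → if s′ <ᵇ s then p (inject₁ r) (σ (inject₁ r) ⟨$⟩ʳ j) else 0) (toℕ-inject₁ r)

      if-0 : ∀ b → (if b then p lastRank (σ lastRank ⟨$⟩ʳ j) else 0) ≡ 0
      if-0 true  = p-last≡0 (σ lastRank ⟨$⟩ʳ j)
      if-0 false = refl

    makespan-dropLast : ∀ σ → makespan P σ ≡ makespan dropLastRank (σ ∘ inject₁)
    makespan-dropLast σ = maxFin-cong m (load-dropLast σ)

    IsLD-dropLast : ∀ σ → IsLD P σ → IsLD dropLastRank (σ ∘ inject₁)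
    IsLD-dropLast σ ld r i i′ lt = subst₂ _≤_ (eq i) (eq i′) (ld (inject₁ r) i i′ lt)
      where
      eq : ∀ i → partialLoad P σ (toℕ (inject₁ r)) (σ (inject₁ r) ⟨$⟩ˡ i) ≡
                 partialLoad dropLastRank (σ ∘ inject₁) (toℕ r) (σ (inject₁ r) ⟨$⟩ˡ i)
      eq i = trans (cong (λ s → partialLoad P σ s (σ (inject₁ r) ⟨$⟩ˡ i)) (toℕ-inject₁ r))
                   (partialLoad-dropLast σ (toℕ r) _)

    IsOptMakespan-dropLast : ∀ {t} → IsOptMakespan P t → IsOptMakespan dropLastRank t
    IsOptMakespan-dropLast {t} ((σ , σ≡t) , min) =
      (σ ∘ inject₁ , trans (sym (makespan-dropLast σ)) σ≡t) ,
      -- `pinch` extends `τ` by repeating its final permutation on the added rank, whose jobs have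
      -- length 0.
      λ τ → subst (t ≤_) (eq τ) (min (τ ∘ pinch (fromℕ n)))
      where
      eq : ∀ τ → makespan P (τ ∘ pinch (fromℕ n)) ≡ makespan dropLastRank τ
      eq τ = trans (makespan-dropLast (τ ∘ pinch (fromℕ n)))
        (maxFin-cong m (λ j → sumFin-cong (suc n) (λ r →
          cong (λ z → p (inject₁ r) (τ z ⟨$⟩ʳ j)) (pinch-inject₁ r))))

  -- Lowering the processing times.

  module Shrink (p-last>0 : 1 ≤ p lastRank first) (σ* : Schedule P) where

    p>0 : ∀ (r : Fin (suc n)) i → 1 ≤ p (inject₁ r) i
    p>0 r i = ≤-trans p-last>0 (sorted (inject₁ r) lastRank i first
      (rank-before i (toℕ first) (subst₂ _<_ (sym (toℕ-inject₁ r)) (sym (toℕ-fromℕ (suc n))) (toℕ<n r))))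

    companion : Fin m → ℕ
    companion i = p lastRank (σ* lastRank ⟨$⟩ʳ (σ* zero ⟨$⟩ˡ i))

    -- 1 ∸ companion i is 1 if the machine of job i has a zero job in the last rank, else 0.
    lowered : Fin m → ℕ
    lowered i = p zero i ∸ (1 ∸ companion i)

    -- Lowering may break the order among jobs of equal size in rank 1.
    sortLowered : Σ[ π ∈ Permutation′ m ] Descending (λ i → lowered (π ⟨$⟩ʳ i))
    sortLowered = sort {_≼_ = λ x y → y ≤ x} (λ x y → ≤-total y x) (λ y≤x z≤y → ≤-trans z≤y y≤x) m lowered

    π = proj₁ sortLowered

    q : Fin (suc (suc n)) → Fin m → ℕ
    q zero    i = lowered (π ⟨$⟩ʳ i)
    q (suc r) i = p (suc r) i ∸ 1

    q-sorted : ∀ r r′ i i′ → toℕ r * m + toℕ i ≤ toℕ r′ * m + toℕ i′ → q r′ i′ ≤ q r i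
    q-sorted zero zero i i′ i≤i′ = proj₂ sortLowered i i′ i≤i′
    -- A rank-1 job loses at most 1 and a later job is lowered by 1 (truncated at 0), so their order
    -- persists.
    q-sorted zero (suc r′) i i′ _ = ∸-mono
      (sorted zero (suc r′) (π ⟨$⟩ʳ i) i′ (rank-before {r = 0} {suc (toℕ r′)} (π ⟨$⟩ʳ i) (toℕ i′) (s≤s z≤n)))
      (m∸n≤m 1 (companion (π ⟨$⟩ʳ i)))
    q-sorted (suc r) zero i i′ i≤i′ = contradiction i≤i′
      (<⇒≱ (<-≤-trans (toℕ<n i′) (≤-trans (m≤m+n m (toℕ r * m)) (m≤m+n _ (toℕ i)))))
    q-sorted (suc r) (suc r′) i i′ h = ∸-monoˡ-≤ 1 (sorted (suc r) (suc r′) i i′ h)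

    shrink : Instance
    shrink = record { k = suc (suc n) ; m = m ; k≥1 = s≤s z≤n ; m≥1 = m≥1 ; p = q ; sorted = q-sorted }

    -- In rank 1 this is clear before re-sorting, and `descending-dominated` with excess 0 carries
    -- it across `π`.
    q≤p : ∀ r i → q r i ≤ p r i
    q≤p zero    i = subst (q zero i ≤_) (+-identityʳ _)
      (descending-dominated π (rank-descending shrink zero) (rank-descending P zero)
        (λ i → ≤-trans (m∸n≤m (p zero (π ⟨$⟩ʳ i)) (1 ∸ companion (π ⟨$⟩ʳ i))) (m≤m+n (p zero (π ⟨$⟩ʳ i)) 0)) i)
    q≤p (suc r) i = m∸n≤m (p (suc r) i) 1

    p≤q+1 : ∀ r i → p r i ≤ q r i + 1
    p≤q+1 zero    = descending-dominated (flip π) (rank-descending P zero) (rank-descending shrink zero)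
      (λ i → subst (λ z → p zero i ≤ lowered z + 1) (sym (inverseʳ π))
        (≤-trans (m≤n+m∸n (p zero i) (1 ∸ companion i))
          (subst (_≤ lowered i + 1) (+-comm (lowered i) (1 ∸ companion i))
            (+-monoʳ-≤ (lowered i) (m∸n≤m 1 (companion i))))))
    p≤q+1 (suc r) i = subst (p (suc r) i ≤_) (+-comm 1 _) (m≤n+m∸n (p (suc r) i) 1)

    shrunkSchedule : Schedule shrink
    -- Undoing `π` lets every machine keep its own rank-1 job, in lowered form.
    shrunkSchedule zero    = σ* zero ∘ₚ flip π
    shrunkSchedule (suc r) = σ* (suc r)

    -- `sumFin-decrease` applied to the machine `j`. The loss is exact and the same on all machines,
    -- which is what preserves rectangularity.
    load-shrink : ∀ j → load P σ* j ≡ load shrink shrunkSchedule j + suc n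
    load-shrink j = trans (sumFin-decrease n (λ r → p r (σ* r ⟨$⟩ʳ j)) (λ r → p>0 r _))
      (cong (λ z → z + sumFin (suc n) (λ r → p (suc r) (σ* (suc r) ⟨$⟩ʳ j) ∸ 1) + suc n)
        (sym (trans (cong lowered (inverseʳ π))
          (cong (λ j′ → p zero (σ* zero ⟨$⟩ʳ j) ∸ (1 ∸ p lastRank (σ* lastRank ⟨$⟩ʳ j′))) (inverseˡ (σ* zero))))))

    rectangular-shrink : Rectangular P σ* → Rectangular shrink shrunkSchedule
    rectangular-shrink rect j j′ = +-cancelʳ-≡ (suc n) _ _
      (trans (sym (load-shrink j)) (trans (rect j j′) (load-shrink j′)))

    -- The machine with the largest job of the last rank carries only nonzero jobs, one from each
    -- rank.
    k≤makespan : suc (suc n) ≤ makespan P σ*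
    k≤makespan = begin
      suc (suc n)                                             ≡⟨ +-comm 1 (suc n) ⟩
      suc n + 1
        ≤⟨ +-mono-≤ (n≤sumFin (suc n) (λ r → p>0 r (σ* (inject₁ r) ⟨$⟩ʳ j))) p-last-j>0 ⟩
      sumFin (suc n) (λ r → p (inject₁ r) (σ* (inject₁ r) ⟨$⟩ʳ j)) + p lastRank (σ* lastRank ⟨$⟩ʳ j)
        ≡⟨ sumFin-init-last (suc n) (λ r → p r (σ* r ⟨$⟩ʳ j)) ⟨
      load P σ* j                                             ≤⟨ ≤maxFin m (load P σ*) j ⟩
      makespan P σ*                                           ∎
      where
      open ≤-Reasoning
      j = σ* lastRank ⟨$⟩ˡ first
      p-last-j>0 : 1 ≤ p lastRank (σ* lastRank ⟨$⟩ʳ j)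
      p-last-j>0 = subst (λ i → 1 ≤ p lastRank i) (sym (inverseʳ (σ* lastRank))) p-last>0

    makespan-shrink : makespan shrink shrunkSchedule + suc n ≤ makespan P σ*
    -- `k≤makespan` ensures that subtracting `suc n` from the makespan is not truncated.
    makespan-shrink = m≤o∸n⇒m+n≤o _ (≤-trans (n≤1+n (suc n)) k≤makespan)
      (maxFin-lub m (λ j → m+n≤o⇒m≤o∸n _
        (subst (_≤ makespan P σ*) (load-shrink j) (≤maxFin m (load P σ*) j))))

    ld-shrink : ∀ σ → IsLD P σ →
                Σ[ τ ∈ Schedule shrink ] IsLD shrink τ × makespan P σ ≤ makespan shrink τ + suc (suc n)
    ld-shrink = IsLD-dominated P q-sorted p≤q+1

    nonzeroJobs-shrink : nonzeroJobs shrink ≤ nonzeroJobs P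
    nonzeroJobs-shrink = sumFin-mono-≤ (suc (suc n)) (λ r → sumFin-mono-≤ m (λ i → mono (q≤p r i)))
      where
      mono : ∀ {x y} → x ≤ y → (if x ≡ᵇ 0 then 0 else 1) ≤ (if y ≡ᵇ 0 then 0 else 1)
      mono {zero}          _ = z≤n
      mono {suc x} {suc y} _ = ≤-refl

    totalTime-shrink : totalTime shrink < totalTime P
    totalTime-shrink = sumFin-mono-< (suc (suc n)) (λ r → sumFin-mono-≤ m (q≤p r)) lastRank
      (sumFin-mono-< m (q≤p lastRank) first (∸-monoʳ-< {o = 0} (s≤s z≤n) p-last>0))

  -- `T` covers both types at once: `closed` asks only that membership follow from a schedule
  -- inheriting rectangularity from `σ*`.
  module _ (σ* σ : Schedule P) (ld : IsLD P σ)
           (opt : IsOptMakespan P (makespan P σ*)) (max : IsLDMakespan P (makespan P σ))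
           (violated : (5 * m ∸ 2) * makespan P σ* < (4 * m ∸ 1) * makespan P σ)
           (ratio≥ : suc (suc n) * makespan P σ* ≤ makespan P σ * suc n)
           (T : Instance → Set)
           (closed : ∀ Q (σ′ : Schedule Q) → (Rectangular P σ* → Rectangular Q σ′) → T Q)
           (minimal : ∀ Q → T Q → Counterexample Q → ¬ Smaller Q P) where

    p-last>0 : 1 ≤ p lastRank first
    p-last>0 = n≢0⇒n>0 λ p≡0 →
      let p-last≡0 : ∀ i → p lastRank i ≡ 0
          p-last≡0 i = n≤0⇒n≡0 (subst (p lastRank i ≤_) p≡0 (≤p-first lastRank i))
      in minimal dropLastRank
        (closed dropLastRank (σ* ∘ inject₁) (λ rect j j′ →
          trans (sym (load-dropLast p-last≡0 σ* j)) (trans (rect j j′) (load-dropLast p-last≡0 σ* j′))))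
        (σ ∘ inject₁ , makespan P σ* , IsLD-dropLast p-last≡0 σ ld , IsOptMakespan-dropLast p-last≡0 opt ,
          subst (λ z → (5 * m ∸ 2) * makespan P σ* < (4 * m ∸ 1) * z) (makespan-dropLast p-last≡0 σ) violated)
        (inj₁ ≤-refl)

    open Shrink p-last>0 σ*

    no-minimal : ⊥
    no-minimal = ratio≥⇒smaller-counterexample (suc n) (makespan P σ) (makespan P σ*) P shrink
        refl refl nonzeroJobs-shrink totalTime-shrink shrunkSchedule makespan-shrink
        (ld-shrink σ ld) max opt k≤makespan violated ratio≥
        λ (counterexample , smaller) →
          minimal shrink (closed shrink shrunkSchedule rectangular-shrink) counterexample smaller

-- Conclusion for both types.

makespan-singleRank : ∀ P → k P ≡ 1 → ∀ σ τ → makespan P σ ≤ makespan P τ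
makespan-singleRank P@(record { k = 1 }) refl σ τ = maxFin-lub (m P) λ j →
  -- The witness is the machine on which `τ` runs the job that `σ` runs on `j`.
  ≤-trans (≤-reflexive (cong (λ i → p P zero i + 0) (sym (inverseʳ (τ zero)))))
    (≤maxFin (m P) (load P τ) (τ zero ⟨$⟩ˡ (σ zero ⟨$⟩ʳ j)))

ratio-bound : ∀ P (T : Instance → Set) (σ* σ : Schedule P) → IsLD P σ →
  IsOptMakespan P (makespan P σ*) → IsLDMakespan P (makespan P σ) →
  (∀ Q (σ′ : Schedule Q) → (Rectangular P σ* → Rectangular Q σ′) → T Q) →
  (∀ Q → T Q → Counterexample Q → ¬ Smaller Q P) →
  (5 * m P ∸ 2) * makespan P σ* < (4 * m P ∸ 1) * makespan P σ →
  makespan P σ * (k P ∸ 1) < k P * makespan P σ*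
ratio-bound record { k = zero ; k≥1 = () }
-- With one rank all schedules have equal makespan, so the ratio is 1 and no violation is possible.
ratio-bound P@(record { k = 1 }) T σ* σ ld opt max closed minimal violated =
  contradiction violated (≤⇒≯ (*-mono-≤ (4m∸1≤5m∸2 (m P) (m≥1 P)) (makespan-singleRank P refl σ σ*)))
ratio-bound record { k = suc (suc n) ; k≥1 = s≤s z≤n ; m = m ; m≥1 = m≥1 ; p = p ; sorted = sorted }
            T σ* σ ld opt max closed minimal violated =
  ≰⇒> λ ratio≥ → ManyRanks.no-minimal n m m≥1 p sorted σ* σ ld opt max violated ratio≥ T closed minimal

ratio-bound-minimal : ∀ P (T : Instance → Set) (σ* : Schedule P) {tLD tstar} →
  IsLDMakespan P tLD → IsOptMakespan P tstar → makespan P σ* ≡ tstar →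
  (∀ Q (σ′ : Schedule Q) → (Rectangular P σ* → Rectangular Q σ′) → T Q) →
  MinimalCounterexample T P → tLD * (k P ∸ 1) < k P * tstar
ratio-bound-minimal P T σ* max@((σ , ld , refl) , ≤tLD) opt refl closed
                    (_ , (σ′ , t , ld′ , t-opt , violated) , minimal) =
  -- The violating schedule `σ′` need not be the worst LD schedule, but the violation passes on to
  -- the larger makespan of `σ`.
  ratio-bound P T σ* σ ld opt max closed minimal (<-≤-trans
    (subst (λ t → (5 * m P ∸ 2) * t < (4 * m P ∸ 1) * makespan P σ′) (IsOptMakespan-unique P t-opt opt) violated)
    (*-monoʳ-≤ (4 * m P ∸ 1) (≤tLD σ′ ld′)))

theorem7p5 : ∀ (P : Instance) (tLD tstar : ℕ) →
    IsLDMakespan P tLD → IsOptMakespan P tstar →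
    MinimalCounterexample TypeIR P ⊎ MinimalCounterexample TypeI P →
    tLD * (k P ∸ 1) < k P * tstar
theorem7p5 P tLD tstar LD opt (inj₁ min@((_ , σ* , t , t-opt , σ*≡t , rect) , _)) =
  -- Here `σ*` is the rectangular optimal schedule; a rectangular schedule of `Q` is automatically
  -- optimal, so `Q` is of Type IR.
  ratio-bound-minimal P TypeIR σ* LD opt (trans σ*≡t (IsOptMakespan-unique P t-opt opt))
    (λ Q σ rectσ → tt , σ , makespan Q σ , rectangular⇒optimal Q σ (rectσ rect) , refl , rectσ rect) min
theorem7p5 P tLD tstar LD opt@((σ* , σ*≡t) , _) (inj₂ min) =
  ratio-bound-minimal P TypeI σ* LD opt σ*≡t (λ _ _ _ → tt) min
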